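{- Let $q$ be a prime power, let $m,n\ge 1$, and let $\mathcal{C}$ be an $[n,k,d]_{q^m/q}$ code. If $\mathcal{C}$ is rank-metric intersecting, then $\mathcal{C}$ is a $(2,1)$-separating rank-metric code.
   Context: Support and rank: fix an $\mathbb{F}_q$-basis $\Gamma$ of $\mathbb{F}_{q^m}$. For $x=(x_1,\dots,x_n)\in\mathbb{F}_{q^m}^n$ let $\mathrm{Mat}_\Gamma(x)\in\mathbb{F}_q^{m\times n}$ be the matrix whose $j$-th column is the coordinate vector of $x_j$ in the basis $\Gamma$. The support $\sigma(x)\subseteq\mathbb{F}_q^n$ is the $\mathbb{F}_q$-row space of $\mathrm{Mat}_\Gamma(x)$, and $\mathrm{rk}(x)=\dim_{\mathbb{F}_q}\sigma(x)$; both are independent of $\Gamma$. An $[n,k,d]_{q^m/q}$ code is an $\mathbb{F}_{q^m}$-linear subspace $\mathcal{C}$ of $\mathbb{F}_{q^m}^n$ with $k=\dim_{\mathbb{F}_{q^m}}\mathcal{C}\ge 1$ and minimum distance $d=\min_{c\in\mathcal{C}\setminus\{0\}}\mathrm{rk}(c)$. The code is rank-metric intersecting if $\sigma(c)\cap\sigma(c')\ne\{0\}$ for all $c,c'\in\mathcal{C}\setminus\{0\}$. A subset $\mathcal{C}\subseteq\mathbb{F}_{q^m}^n$ is a $(2,1)$-separating rank-metric code if all pairwise distinct $x,y,z\in\mathcal{C}$ satisfy $\mathrm{rk}(x-z)<\mathrm{rk}(x-y)+\mathrm{rk}(y-z)$. -}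

module Defs where

open import Level using (Level; _⊔_; 0ℓ) renaming (suc to lsuc)
open import Algebra.Apartness.Bundles using (HeytingField; HeytingCommutativeRing)
open import Algebra.Bundles using (Ring; CommutativeRing; Group)
open import Algebra.Module.Bundles using (LeftModule)
import Algebra.Module.Construct.TensorUnit as TensorUnit
open import Algebra.Morphism.Structures using (IsRingHomomorphism)
import Algebra.Properties.Monoid.Sum as MonoidSum
import Algebra.Properties.Ring as RingProperties
import Algebra.Module.Properties.LeftModule as LeftModuleProperties
open import Data.Fin.Base using (Fin; zero; suc)
import Data.Fin.Properties as Fin
open import Data.Nat.Base using (ℕ; zero; suc; _^_; _≤_; _<_) renaming (_+_ to _+ℕ_)
open import Data.Nat.Primality using (Prime)
open import Data.Product.Base using (Σ; ∃; ∃-syntax; _×_; _,_; proj₁; proj₂)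
open import Data.Unit.Base using (tt)
open import Data.Vec.Functional using (Vector; []; _∷_; head; tail)
open import Function.Base using (_∘_)
open import Function.Bundles using (Inverse)
open import Relation.Binary.Definitions using (Decidable)
open import Relation.Binary.PropositionalEquality.Core as ≡ using (_≡_)
import Relation.Binary.PropositionalEquality.Properties as ≡
import Relation.Binary.Reasoning.Setoid as SetoidReasoning
open import Relation.Nullary.Decidable.Core using (Dec; yes; no; map′)
open import Relation.Nullary.Negation.Core using (¬_; contradiction)
open import Relation.Unary using (Pred; U; _∈_; _⊆_; _∩_; _≐_)

IsPrimePower : ℕ → Set
IsPrimePower q = ∃[ p ] ∃[ e ] Prime p × 1 ≤ e × q ≡ p ^ e

-- With a finite carrier, equality and invertibility are decidable, so apartness
-- is just inequality and a Heyting field is a field in the classical sense.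
record FiniteField (c ℓ₁ ℓ₂ : Level) (q : ℕ) : Set (lsuc (c ⊔ ℓ₁ ⊔ ℓ₂)) where
  field
    heytingField : HeytingField c ℓ₁ ℓ₂

  open HeytingField heytingField public
    using (Carrier; _≈_; _#_; _+_; _*_; -_; 0#; 1#; #⇒invertible; tight)

  commutativeRing : CommutativeRing c ℓ₁
  commutativeRing = HeytingCommutativeRing.commutativeRing
    (HeytingField.heytingCommutativeRing heytingField)

  open CommutativeRing commutativeRing public using (ring; rawRing; setoid)

  field
    enumeration : Inverse setoid (≡.setoid (Fin q))

module Linear
  {r ℓr m ℓm : Level} {R : Ring r ℓr} (M : LeftModule R m ℓm) where

  open Ring R using (Carrier; _≈_; 0#)
  open LeftModule M
  open MonoidSum +ᴹ-monoid using (sum)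

  linearCombination : ∀ {k} → Vector Carrier k → Vector Carrierᴹ k → Carrierᴹ
  linearCombination a v = sum (λ i → a i *ₗ v i)

  Span : ∀ {k} → Vector Carrierᴹ k → Pred Carrierᴹ (r ⊔ ℓm)
  Span {k} v x = ∃[ a ] x ≈ᴹ linearCombination {k} a v

  LinearlyIndependent : ∀ {k} → Vector Carrierᴹ k → Set (r ⊔ ℓr ⊔ ℓm)
  LinearlyIndependent v =
    ∀ a → linearCombination a v ≈ᴹ 0ᴹ → ∀ i → a i ≈ 0#

  record IsSubspace {p} (V : Pred Carrierᴹ p) : Set (r ⊔ m ⊔ ℓm ⊔ p) where
    field
      resp  : ∀ {x y} → x ≈ᴹ y → x ∈ V → y ∈ V
      0∈    : 0ᴹ ∈ V
      +∈    : ∀ {x y} → x ∈ V → y ∈ V → x +ᴹ y ∈ V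
      *∈    : ∀ a {x} → x ∈ V → a *ₗ x ∈ V

  record IsBasis {p} (V : Pred Carrierᴹ p) {k} (v : Vector Carrierᴹ k)
                 : Set (r ⊔ ℓr ⊔ m ⊔ ℓm ⊔ p) where
    field
      member      : ∀ i → v i ∈ V
      spanning    : V ⊆ Span v
      independent : LinearlyIndependent v

  HasDimension : ∀ {p} → Pred Carrierᴹ p → ℕ → Set (r ⊔ ℓr ⊔ m ⊔ ℓm ⊔ p)
  HasDimension V k = Σ (Vector Carrierᴹ k) (IsBasis V)

  Zero : Pred Carrierᴹ ℓm
  Zero x = x ≈ᴹ 0ᴹ

power : ∀ {r ℓr m ℓm} {R : Ring r ℓr} → LeftModule R m ℓm → ℕ → LeftModule R m ℓm
power M n = record
  { Carrierᴹ = Vector Carrierᴹ n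
  ; _≈ᴹ_ = λ x y → ∀ j → x j ≈ᴹ y j
  ; _+ᴹ_ = λ x y j → x j +ᴹ y j
  ; _*ₗ_ = λ a x j → a *ₗ x j
  ; 0ᴹ = λ _ → 0ᴹ
  ; -ᴹ_ = λ x j → -ᴹ x j
  ; isLeftModule = record
    { isLeftSemimodule = record
      { +ᴹ-isCommutativeMonoid = record
        { isMonoid = record
          { isSemigroup = record
            { isMagma = record
              { isEquivalence = record
                { refl = λ _ → ≈ᴹ-refl
                ; sym = λ e j → ≈ᴹ-sym (e j)
                ; trans = λ e f j → ≈ᴹ-trans (e j) (f j)
                }
              ; ∙-cong = λ e f j → +ᴹ-cong (e j) (f j)
              }
            ; assoc = λ x y z j → +ᴹ-assoc (x j) (y j) (z j)
            }
          ; identity = (λ x j → +ᴹ-identityˡ (x j)) , (λ x j → +ᴹ-identityʳ (x j))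
          }
        ; comm = λ x y j → +ᴹ-comm (x j) (y j)
        }
      ; isPreleftSemimodule = record
        { *ₗ-cong = λ e f j → *ₗ-cong e (f j)
        ; *ₗ-zeroˡ = λ x j → *ₗ-zeroˡ (x j)
        ; *ₗ-distribʳ = λ x a b j → *ₗ-distribʳ (x j) a b
        ; *ₗ-identityˡ = λ x j → *ₗ-identityˡ (x j)
        ; *ₗ-assoc = λ a b x j → *ₗ-assoc a b (x j)
        ; *ₗ-zeroʳ = λ a j → *ₗ-zeroʳ a
        ; *ₗ-distribˡ = λ a x y j → *ₗ-distribˡ a (x j) (y j)
        }
      }
    ; -ᴹ‿cong = λ e j → -ᴹ‿cong (e j)
    ; -ᴹ‿inverse = (λ x j → -ᴹ‿inverseˡ (x j)) , (λ x j → -ᴹ‿inverseʳ (x j))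
    }
  }
  where open LeftModule M

restrictScalars : ∀ {r ℓr s ℓs m ℓm} {R : Ring r ℓr} {S : Ring s ℓs}
  (ι : Ring.Carrier R → Ring.Carrier S) →
  IsRingHomomorphism (Ring.rawRing R) (Ring.rawRing S) ι →
  LeftModule S m ℓm → LeftModule R m ℓm
restrictScalars ι ι-homo M = record
  { Carrierᴹ = Carrierᴹ
  ; _≈ᴹ_ = _≈ᴹ_
  ; _+ᴹ_ = _+ᴹ_
  ; _*ₗ_ = λ a x → ι a *ₗ x
  ; 0ᴹ = 0ᴹ
  ; -ᴹ_ = -ᴹ_
  ; isLeftModule = record
    { isLeftSemimodule = record
      { +ᴹ-isCommutativeMonoid = +ᴹ-isCommutativeMonoid
      ; isPreleftSemimodule = record
        { *ₗ-cong = λ e → *ₗ-cong (⟦⟧-cong e)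
        ; *ₗ-zeroˡ = λ x → ≈ᴹ-trans (*ₗ-congʳ 0#-homo) (*ₗ-zeroˡ x)
        ; *ₗ-distribʳ = λ x a b → ≈ᴹ-trans (*ₗ-congʳ (+-homo a b)) (*ₗ-distribʳ x (ι a) (ι b))
        ; *ₗ-identityˡ = λ x → ≈ᴹ-trans (*ₗ-congʳ 1#-homo) (*ₗ-identityˡ x)
        ; *ₗ-assoc = λ a b x → ≈ᴹ-trans (*ₗ-congʳ (*-homo a b)) (*ₗ-assoc (ι a) (ι b) x)
        ; *ₗ-zeroʳ = λ a → *ₗ-zeroʳ (ι a)
        ; *ₗ-distribˡ = λ a → *ₗ-distribˡ (ι a)
        }
      }
    ; -ᴹ‿cong = -ᴹ‿cong
    ; -ᴹ‿inverse = -ᴹ‿inverse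
    }
  }
  where
  open LeftModule M
  open IsRingHomomorphism ι-homo

-- Leads up to span-dimension, which makes the rank a total function: subspaces
-- have no dimension constructively until membership in spans is decidable.
module FiniteFieldProperties {c ℓ₁ ℓ₂ q} (F : FiniteField c ℓ₁ ℓ₂ q) where
  open FiniteField F
  open CommutativeRing commutativeRing
    using (refl; sym; trans; _-_; +-congˡ; +-identityʳ; *-congʳ; *-congˡ; -‿inverseʳ)
  open RingProperties ring using (-0#≈0#)
  open Inverse enumeration using (to; from; strictlyInverseʳ)

  infix 4 _≈?_
  _≈?_ : Decidable _≈_
  x ≈? y = map′
    (λ e → trans (sym (strictlyInverseʳ x))
             (trans (Inverse.from-cong enumeration e) (strictlyInverseʳ y)))
    (Inverse.to-cong enumeration)
    (to x Fin.≟ to y)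

  search : ∀ {p} {P : Pred Carrier p} → (∀ {x y} → x ≈ y → P x → P y) →
           (∀ x → Dec (P x)) → Dec (∃ P)
  search resp P? = map′
    (λ (i , p) → from i , p)
    (λ (x , p) → to x , resp (sym (strictlyInverseʳ x)) p)
    (Fin.any? (λ i → P? (from i)))

  searchVector : ∀ {p} k {P : Pred (Vector Carrier k) p} →
    (∀ {a b} → (∀ i → a i ≈ b i) → P a → P b) →
    (∀ a → Dec (P a)) → Dec (∃ P)
  searchVector zero resp P? = map′
    (λ p → [] , p) (λ (a , p) → resp (λ ()) p) (P? [])
  searchVector (suc k) {P} resp P? = map′
    (λ (x , a , p) → x ∷ a , p)
    (λ (a , p) → head a , tail a , resp (λ { zero → refl ; (suc i) → refl }) p)
    (search
      (λ e (a , p) → a , resp (λ { zero → e ; (suc i) → refl }) p)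
      (λ x → searchVector k
        (λ e → resp (λ { zero → refl ; (suc i) → e i }))
        (λ a → P? (x ∷ a))))

  leftInverse : ∀ x → ¬ x ≈ 0# → ∃[ y ] y * x ≈ 1#
  leftInverse x x≉0
    with search {P = λ y → y * x ≈ 1#} (λ e p → trans (*-congʳ (sym e)) p)
                (λ y → y * x ≈? 1#)
  ... | yes inv = inv
  ... | no ¬inv = contradiction (proj₁ (tight x 0#) x¬#0) x≉0
    where
    x-0≈x : x - 0# ≈ x
    x-0≈x = trans (+-congˡ -0#≈0#) (+-identityʳ x)

    x¬#0 : ¬ x # 0#
    x¬#0 x#0 with y , yx≈1 , _ ← #⇒invertible x#0 =
      ¬inv (y , trans (*-congˡ (sym x-0≈x)) yx≈1)

  module _ {m ℓm} (M : LeftModule ring m ℓm) where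
    open LeftModule M
    open Linear M
    open MonoidSum +ᴹ-monoid using (sum-cong-≋)
    open SetoidReasoning ≈ᴹ-setoid

    linearCombination-cong : ∀ {k} {a b : Vector Carrier k} (v : Vector Carrierᴹ k) →
      (∀ i → a i ≈ b i) → linearCombination a v ≈ᴹ linearCombination b v
    linearCombination-cong v e = sum-cong-≋ (λ i → *ₗ-congʳ (e i))

    linearCombination-* : ∀ {k} s (a : Vector Carrier k) v →
      s *ₗ linearCombination a v ≈ᴹ linearCombination (λ i → s * a i) v
    linearCombination-* {zero}  s a v = *ₗ-zeroʳ s
    linearCombination-* {suc k} s a v = ≈ᴹ-trans (*ₗ-distribˡ s _ _)
      (+ᴹ-cong (≈ᴹ-sym (*ₗ-assoc s (a zero) (v zero)))
               (linearCombination-* s (tail a) (tail v)))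

    linearCombination-0 : ∀ {k} (v : Vector Carrierᴹ k) →
      linearCombination (λ _ → 0#) v ≈ᴹ 0ᴹ
    linearCombination-0 {zero}  v = ≈ᴹ-refl
    linearCombination-0 {suc k} v =
      ≈ᴹ-trans (+ᴹ-cong (*ₗ-zeroˡ _) (linearCombination-0 (tail v))) (+ᴹ-identityˡ 0ᴹ)

    linearCombination-+ : ∀ {k} (a b : Vector Carrier k) v →
      linearCombination a v +ᴹ linearCombination b v
        ≈ᴹ linearCombination (λ i → a i + b i) v
    linearCombination-+ {zero}  a b v = +ᴹ-identityˡ 0ᴹ
    linearCombination-+ {suc k} a b v = begin
      (a₀ +ᴹ A) +ᴹ (b₀ +ᴹ B)   ≈⟨ +ᴹ-assoc a₀ A _ ⟩
      a₀ +ᴹ (A +ᴹ (b₀ +ᴹ B))   ≈⟨ +ᴹ-congˡ (+ᴹ-assoc A b₀ B) ⟨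
      a₀ +ᴹ ((A +ᴹ b₀) +ᴹ B)   ≈⟨ +ᴹ-congˡ (+ᴹ-congʳ (+ᴹ-comm A b₀)) ⟩
      a₀ +ᴹ ((b₀ +ᴹ A) +ᴹ B)   ≈⟨ +ᴹ-congˡ (+ᴹ-assoc b₀ A B) ⟩
      a₀ +ᴹ (b₀ +ᴹ (A +ᴹ B))   ≈⟨ +ᴹ-assoc a₀ b₀ _ ⟨
      (a₀ +ᴹ b₀) +ᴹ (A +ᴹ B)   ≈⟨ +ᴹ-cong (≈ᴹ-sym (*ₗ-distribʳ (v zero) (a zero) (b zero)))
                                          (linearCombination-+ (tail a) (tail b) (tail v)) ⟩
      linearCombination (λ i → a i + b i) v ∎
      where
      a₀ = a zero *ₗ v zero
      b₀ = b zero *ₗ v zero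
      A = linearCombination (tail a) (tail v)
      B = linearCombination (tail b) (tail v)

    Span-resp : ∀ {k} {v : Vector Carrierᴹ k} {x y} → x ≈ᴹ y → x ∈ Span v → y ∈ Span v
    Span-resp e (a , p) = a , ≈ᴹ-trans (≈ᴹ-sym e) p

    Span-+ : ∀ {k} {v : Vector Carrierᴹ k} {x y} →
             x ∈ Span v → y ∈ Span v → x +ᴹ y ∈ Span v
    Span-+ {v = v} (a , p) (b , p′) =
      (λ i → a i + b i) , ≈ᴹ-trans (+ᴹ-cong p p′) (linearCombination-+ a b v)

    Span-* : ∀ {k} {v : Vector Carrierᴹ k} s {x} → x ∈ Span v → s *ₗ x ∈ Span v
    Span-* {v = v} s (a , p) =
      (λ i → s * a i) , ≈ᴹ-trans (*ₗ-congˡ p) (linearCombination-* s a v)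

    Span-0 : ∀ {k} {v : Vector Carrierᴹ k} → 0ᴹ ∈ Span v
    Span-0 {v = v} = (λ _ → 0#) , ≈ᴹ-sym (linearCombination-0 v)

    Span-least : ∀ {k l} {v : Vector Carrierᴹ k} {w : Vector Carrierᴹ l} →
                 (∀ i → v i ∈ Span w) → Span v ⊆ Span w
    Span-least {v = v} {w} v∈ (a , p) = Span-resp (≈ᴹ-sym p) (go a v v∈)
      where
      go : ∀ {k} a (v : Vector Carrierᴹ k) → (∀ i → v i ∈ Span w) →
           linearCombination a v ∈ Span w
      go {zero}  a v v∈ = Span-0
      go {suc k} a v v∈ =
        Span-+ (Span-* (a zero) (v∈ zero)) (go (tail a) (tail v) (v∈ ∘ suc))

    Span-tail : ∀ {k} {v : Vector Carrierᴹ (suc k)} → Span (tail v) ⊆ Span v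
    Span-tail {v = v} (a , p) = (0# ∷ a) ,
      ≈ᴹ-trans p (≈ᴹ-sym (≈ᴹ-trans (+ᴹ-congʳ (*ₗ-zeroˡ (v zero))) (+ᴹ-identityˡ _)))

    Span-head : ∀ {k} {v : Vector Carrierᴹ (suc k)} → v zero ∈ Span v
    Span-head {v = v} = (1# ∷ λ _ → 0#) , ≈ᴹ-sym
      (≈ᴹ-trans (+ᴹ-cong (*ₗ-identityˡ (v zero)) (linearCombination-0 (tail v)))
                (+ᴹ-identityʳ _))

    independent-∷ : ∀ {k} x {v : Vector Carrierᴹ k} → ¬ x ∈ Span v →
                    LinearlyIndependent v → LinearlyIndependent (x ∷ v)
    independent-∷ x {v} x∉ ind a eq with a zero ≈? 0#
    ... | yes a₀≈0 = λ where
      zero    → a₀≈0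
      (suc i) → ind (tail a) (begin
        linearCombination (tail a) v                ≈⟨ +ᴹ-identityˡ _ ⟨
        0ᴹ +ᴹ linearCombination (tail a) v          ≈⟨ +ᴹ-congʳ (≈ᴹ-trans (*ₗ-congʳ a₀≈0) (*ₗ-zeroˡ x)) ⟨
        a zero *ₗ x +ᴹ linearCombination (tail a) v ≈⟨ eq ⟩
        0ᴹ ∎) i
    ... | no a₀≉0 with y , ya₀≈1 ← leftInverse (a zero) a₀≉0 =
      contradiction (Span-resp (≈ᴹ-sym x≈) (Span-* y (Span-neg (tail a , ≈ᴹ-refl)))) x∉
      where
      A = linearCombination (tail a) v

      neg : (- 1#) *ₗ A ≈ᴹ -ᴹ A
      neg = LeftModuleProperties.inverseʳ-uniqueᴹ M A ((- 1#) *ₗ A) (begin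
        A +ᴹ (- 1#) *ₗ A         ≈⟨ +ᴹ-congʳ (*ₗ-identityˡ A) ⟨
        1# *ₗ A +ᴹ (- 1#) *ₗ A   ≈⟨ *ₗ-distribʳ A 1# (- 1#) ⟨
        (1# + - 1#) *ₗ A         ≈⟨ *ₗ-congʳ (-‿inverseʳ 1#) ⟩
        0# *ₗ A                  ≈⟨ *ₗ-zeroˡ A ⟩
        0ᴹ ∎)

      Span-neg : A ∈ Span v → -ᴹ A ∈ Span v
      Span-neg s = Span-resp neg (Span-* (- 1#) s)

      x≈ : x ≈ᴹ y *ₗ (-ᴹ A)
      x≈ = begin
        x                     ≈⟨ *ₗ-identityˡ x ⟨
        1# *ₗ x               ≈⟨ *ₗ-congʳ ya₀≈1 ⟨
        (y * a zero) *ₗ x     ≈⟨ *ₗ-assoc y (a zero) x ⟩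
        y *ₗ (a zero *ₗ x)    ≈⟨ *ₗ-congˡ (LeftModuleProperties.inverseˡ-uniqueᴹ M _ A eq) ⟩
        y *ₗ (-ᴹ A) ∎

    Span-member : ∀ {k} (v : Vector Carrierᴹ k) i → v i ∈ Span v
    Span-member v zero    = Span-head {v = v}
    Span-member v (suc i) = Span-tail {v = v} (Span-member (tail v) i)

    span-dimension : Decidable _≈ᴹ_ → ∀ {k} (v : Vector Carrierᴹ k) →
                     ∃ (HasDimension (Span v))
    span-dimension _≟_ {zero} v = zero , [] , record
      { member      = λ ()
      ; spanning    = λ (a , p) → [] , p
      ; independent = λ _ _ ()
      }
    span-dimension _≟_ {suc k} v
      with l , b , basis ← span-dimension _≟_ (tail v)
      with searchVector l {P = λ a → v zero ≈ᴹ linearCombination a b}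
             (λ e p → ≈ᴹ-trans p (linearCombination-cong b e))
             (λ a → v zero ≟ linearCombination a b)
    ... | yes v₀∈ = l , b , record
      { member      = Span-tail {v = v} ∘ IsBasis.member basis
      ; spanning    = Span-least {v = v} {w = b} λ where
          zero    → v₀∈
          (suc i) → IsBasis.spanning basis (Span-member (tail v) i)
      ; independent = IsBasis.independent basis
      }
    ... | no v₀∉ = suc l , v₀∷b , record
      { member      = λ where
          zero    → Span-head {v = v}
          (suc i) → Span-tail {v = v} (IsBasis.member basis i)
      ; spanning    = Span-least {v = v} {w = v₀∷b} λ where
          zero    → Span-head {v = v₀∷b}
          (suc i) → Span-tail {v = v₀∷b}
                      (IsBasis.spanning basis (Span-member (tail v) i))
      ; independent = independent-∷ (v zero) v₀∉ (IsBasis.independent basis)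
      }
      where
      v₀∷b : Vector Carrierᴹ (suc l)
      v₀∷b = v zero ∷ b

record Extension {c ℓ₁ ℓ₂ c′ ℓ₁′ ℓ₂′ q q′}
                 (K : FiniteField c ℓ₁ ℓ₂ q) (L : FiniteField c′ ℓ₁′ ℓ₂′ q′)
                 : Set (c ⊔ ℓ₁ ⊔ c′ ⊔ ℓ₁′) where
  private
    module K = FiniteField K
    module L = FiniteField L

  field
    ι      : K.Carrier → L.Carrier
    ι-homo : IsRingHomomorphism K.rawRing L.rawRing ι

  L-over-K : LeftModule K.ring c′ ℓ₁′
  L-over-K = restrictScalars ι ι-homo (TensorUnit.leftModule {R = L.ring})

  -- A K-basis of the whole of L with the given number of elements.
  Basis : ℕ → Set (c ⊔ ℓ₁ ⊔ c′ ⊔ ℓ₁′)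
  Basis = HasDimension {p = 0ℓ} U
    where open Linear L-over-K

module RankMetric {c ℓ₁ ℓ₂ c′ ℓ₁′ ℓ₂′ q q′}
  {K : FiniteField c ℓ₁ ℓ₂ q} {L : FiniteField c′ ℓ₁′ ℓ₂′ q′}
  (E : Extension K L) {m : ℕ} (Γ : Extension.Basis E m) (n : ℕ) where

  private
    module K = FiniteField K
    module L = FiniteField L

  Kⁿ : LeftModule K.ring c ℓ₁
  Kⁿ = power TensorUnit.leftModule n

  Lⁿ : LeftModule L.ring c′ ℓ₁′
  Lⁿ = power TensorUnit.leftModule n

  open LeftModule Lⁿ using (Carrierᴹ; _≉ᴹ_; 0ᴹ; +ᴹ-group)
  open Group +ᴹ-group using () renaming (_//_ to _-ᴹ_)
  open Linear Kⁿ using (Span; Zero)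

  -- The coefficients are unique, by independence of Γ.
  coordinates : L.Carrier → Vector K.Carrier m
  coordinates y = proj₁ (Linear.IsBasis.spanning (proj₂ Γ) {y} tt)

  Mat : Carrierᴹ → Fin m → Fin n → K.Carrier
  Mat x i j = coordinates (x j) i

  -- Span (Mat x) is the span of the rows, Mat x being indexed by rows first.
  σ : Carrierᴹ → Pred (Vector K.Carrier n) (c ⊔ ℓ₁)
  σ x = Span (Mat x)

  σ-dimension : ∀ x → ∃ (Linear.HasDimension Kⁿ (σ x))
  σ-dimension x = span-dimension Kⁿ (λ u v → Fin.all? (λ j → u j ≈? v j)) (Mat x)
    where open FiniteFieldProperties K

  -- The length of a basis of σ x; all bases of σ x have the same length.
  rk : Carrierᴹ → ℕ
  rk x = proj₁ (σ-dimension x)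

  module _ {p} (C : Pred Carrierᴹ p) where

    record IsMinimumDistance (d : ℕ) : Set (c′ ⊔ ℓ₁′ ⊔ p) where
      field
        attained   : ∃[ x ] x ∈ C × x ≉ᴹ 0ᴹ × rk x ≡ d
        lowerBound : ∀ {x} → x ∈ C → x ≉ᴹ 0ᴹ → d ≤ rk x

    record IsCode (k d : ℕ) : Set (c′ ⊔ ℓ₁′ ⊔ p) where
      field
        isSubspace        : Linear.IsSubspace Lⁿ C
        1≤k               : 1 ≤ k
        hasDimension      : Linear.HasDimension Lⁿ C k
        isMinimumDistance : IsMinimumDistance d

    Intersecting : Set (c ⊔ ℓ₁ ⊔ c′ ⊔ ℓ₁′ ⊔ p)
    Intersecting = ∀ {x y} → x ∈ C → y ∈ C → x ≉ᴹ 0ᴹ → y ≉ᴹ 0ᴹ →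
                   ¬ (σ x ∩ σ y ≐ Zero)

    Separating₂₁ : Set (c′ ⊔ ℓ₁′ ⊔ p)
    Separating₂₁ = ∀ {x y z} → x ∈ C → y ∈ C → z ∈ C →
                   x ≉ᴹ y → y ≉ᴹ z → x ≉ᴹ z →
                   rk (x -ᴹ z) < rk (x -ᴹ y) +ℕ rk (y -ᴹ z)

{-# OPTIONS --safe #-}

-- Put c = x − y and c′ = y − z, nonzero codewords with x − z = c + c′, so that every
-- row of Mat (x − z) is the sum of a row of Mat c and one of Mat c′. Let u be a
-- basis of σ (x − z), of length t, and split u i = y i + y′ i along σ c + σ c′. If h
-- is a nonzero vector of σ c ∩ σ c′, then the t + 1 pairs (y i , y′ i) and (h , −h)
-- are linearly independent in σ c ⊕ σ c′, since adding the components recovers first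
-- the coefficients of u and then that of h. Counting the combinations of these
-- pairs gives q ^ (t + 1) ≤ q ^ (rk c + rk c′).
module Submission where

open import Defs
open import Level using (Level)
open import Data.Nat.Base using (ℕ; _^_; _≤_)
open import Relation.Unary using (Pred)
open import Algebra.Module.Bundles using (LeftModule)
open import Algebra.Bundles using (CommutativeMonoid; CommutativeRing)
import Algebra.Properties.CommutativeMonoid.Sum as CommutativeMonoidSum
import Algebra.Properties.CommutativeSemigroup as CommutativeSemigroupProperties
import Algebra.Properties.AbelianGroup as AbelianGroupProperties
import Algebra.Properties.Ring as RingProperties
open import Data.Fin.Base using (Fin; zero; suc; finToFun; funToFin; combine; _↑ˡ_; _↑ʳ_)
import Data.Fin.Properties as Fin
open import Data.Nat.Base using (suc; _<_; nonTrivial⇒n>1) renaming (_+_ to _+ℕ_)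
import Data.Nat.Properties as ℕ
open import Data.Nat.Primality using (prime⇒nonTrivial)
open import Data.Product.Base using (∃-syntax; _×_; _,_; proj₁; proj₂)
open import Data.Unit.Base using (tt)
open import Data.Vec.Functional using (Vector; _++_; head; tail)
open import Data.Vec.Functional.Properties using (lookup-++ˡ; lookup-++ʳ)
open import Function.Base using (_∘_)
open import Function.Bundles using (Inverse; Injection)
open import Function.Properties.Inverse using (Inverse⇒Injection; sym)
open import Relation.Binary.PropositionalEquality as ≡ using (_≡_; refl)
import Relation.Binary.Reasoning.Setoid as SetoidReasoning
open import Relation.Nullary.Decidable.Core using (decidable-stable)
open import Relation.Nullary.Negation.Core using (¬_)
open import Relation.Unary using (_∈_)

-- Arithmetic of powers, and encoding of functions between finite sets.

primePower⇒1< : ∀ {q} → IsPrimePower q → 1 < q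
primePower⇒1< (p , e , pr , 1≤e , refl) =
  ℕ.^-monoʳ-< p (nonTrivial⇒n>1 p {{prime⇒nonTrivial pr}}) 1≤e

^-cancelʳ-≤ : ∀ {q} → 1 < q → ∀ {a b} → q ^ a ≤ q ^ b → a ≤ b
^-cancelʳ-≤ {q} 1<q q^a≤q^b = ℕ.≮⇒≥ (λ b<a → ℕ.<⇒≱ (ℕ.^-monoʳ-< q 1<q b<a) q^a≤q^b)

-- Functions are only known to agree pointwise, so `≡.cong` does not apply.
funToFin-cong : ∀ {m n} {f g : Fin m → Fin n} → (∀ i → f i ≡ g i) →
                funToFin f ≡ funToFin g
funToFin-cong {ℕ.zero} f≗g = refl
funToFin-cong {suc m}  f≗g = ≡.cong₂ combine (f≗g zero) (funToFin-cong (f≗g ∘ suc))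

-- Counting vectors over a finite field.

module FiniteFieldLemmas {c ℓ₁ ℓ₂ q} (F : FiniteField c ℓ₁ ℓ₂ q) where
  open FiniteField F
  open CommutativeRing commutativeRing
    using (-‿inverseʳ; *-congˡ; *-congʳ; *-assoc; *-comm; *-identityˡ)
    renaming (sym to ≈-sym; trans to ≈-trans)
  open RingProperties ring using (x∙y⁻¹≈ε⇒x≈y)
  open Inverse enumeration using (to; from)
  open FiniteFieldProperties F

  to-injective : ∀ {x y} → to x ≡ to y → x ≈ y
  to-injective = Injection.injective (Inverse⇒Injection enumeration)

  from-injective : ∀ {i j} → from i ≈ from j → i ≡ j
  from-injective = Injection.injective (Inverse⇒Injection (sym enumeration))

  *-cancelʳ : ∀ {x} s t → ¬ x ≈ 0# → s * x ≈ t * x → s ≈ t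
  *-cancelʳ {x} s t x≉0 sx≈tx with y , yx≈1 ← leftInverse x x≉0 =
    ≈-trans (≈-sym (undo s)) (≈-trans (*-congˡ sx≈tx) (undo t))
    where
    undo : ∀ s → y * (s * x) ≈ s
    undo s = begin
      y * (s * x)  ≈⟨ *-congˡ (*-comm s x) ⟩
      y * (x * s)  ≈⟨ *-assoc y x s ⟨
      (y * x) * s  ≈⟨ *-congʳ yx≈1 ⟩
      1# * s       ≈⟨ *-identityˡ s ⟩
      s            ∎
      where open SetoidReasoning setoid

  -- This counting replaces an exchange argument: an injection gives `q ^ a ≤ q ^ b`, and `1 < q`
  -- lets the exponents be compared. No linearity of `f` is asked for, so coefficients read off from
  -- membership proofs can be used directly.
  vectorInjection⇒≤ : 1 < q → ∀ {a b} (f : Vector Carrier a → Vector Carrier b) →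
    (∀ {x y} → (∀ i → f x i ≈ f y i) → ∀ i → x i ≈ y i) → a ≤ b
  vectorInjection⇒≤ 1<q {a} {b} f f-injective =
    ^-cancelʳ-≤ 1<q (Fin.injective⇒≤ {f = code} code-injective)
    where
    -- One representative per class of vectors under pointwise `_≈_`; `f` is evaluated on these
    -- only.
    decode : Fin (q ^ a) → Vector Carrier a
    decode k i = from (finToFun {q} {a} k i)

    code : Fin (q ^ a) → Fin (q ^ b)
    code k = funToFin (to ∘ f (decode k))

    code-injective : ∀ {k l} → code k ≡ code l → k ≡ l
    code-injective {k} {l} eq = begin
      k                               ≡⟨ Fin.funToFin-finToFin {a} k ⟨
      funToFin (finToFun {q} {a} k)   ≡⟨ funToFin-cong (λ i → from-injective
                                           (f-injective {decode k} {decode l} fk≈fl i)) ⟩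
      funToFin (finToFun {q} {a} l)   ≡⟨ Fin.funToFin-finToFin {a} l ⟩
      l                               ∎
      where
      open ≡.≡-Reasoning

      fk≈fl : ∀ i → f (decode k) i ≈ f (decode l) i
      fk≈fl i = to-injective (begin
        to (f (decode k) i)    ≡⟨ Fin.finToFun-funToFin (to ∘ f (decode k)) i ⟨
        finToFun (code k) i    ≡⟨ ≡.cong (λ k → finToFun k i) eq ⟩
        finToFun (code l) i    ≡⟨ Fin.finToFun-funToFin (to ∘ f (decode l)) i ⟩
        to (f (decode l) i)    ∎)

  -- Linear combinations and spans in a module.

  module _ {m ℓm} (M : LeftModule ring m ℓm) where
    open LeftModule M
    open Linear M
    open CommutativeMonoidSum +ᴹ-commutativeMonoid using (sum-cong-≋; ∑-distrib-+)
    open SetoidReasoning ≈ᴹ-setoid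

    linearCombination-congʳ : ∀ {k} (a : Vector Carrier k) {v w} →
      (∀ i → v i ≈ᴹ w i) → linearCombination a v ≈ᴹ linearCombination a w
    linearCombination-congʳ a e = sum-cong-≋ (λ i → *ₗ-congˡ (e i))

    linearCombination-+ᴹ : ∀ {k} (a : Vector Carrier k) v w →
      linearCombination a (λ i → v i +ᴹ w i)
        ≈ᴹ linearCombination a v +ᴹ linearCombination a w
    linearCombination-+ᴹ a v w = ≈ᴹ-trans
      (sum-cong-≋ (λ i → *ₗ-distribˡ (a i) (v i) (w i)))
      (∑-distrib-+ (λ i → a i *ₗ v i) (λ i → a i *ₗ w i))

    linearCombination∈Span : ∀ {k l} (a : Vector Carrier k) {v} {w : Vector Carrierᴹ l} →
      (∀ i → v i ∈ Span w) → linearCombination a v ∈ Span w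
    linearCombination∈Span a {v} v∈ = Span-least M v∈ (a , ≈ᴹ-refl)

    independent⇒injective : ∀ {k} {v : Vector Carrierᴹ k} → LinearlyIndependent v →
      ∀ {a b} → linearCombination a v ≈ᴹ linearCombination b v → ∀ i → a i ≈ b i
    independent⇒injective {v = v} ind {a} {b} eq i =
      -- `-B` is the combination with coefficients `- b i`. Adding it to both sides of `eq` makes
      -- the differences `a i + - b i` the coefficients of a vanishing combination.
      x∙y⁻¹≈ε⇒x≈y (a i) (b i) (ind (λ i → a i + - b i) (begin
        linearCombination (λ i → a i + - b i) v   ≈⟨ linearCombination-+ M a (-_ ∘ b) v ⟨
        linearCombination a v +ᴹ -B                ≈⟨ +ᴹ-congʳ eq ⟩
        linearCombination b v +ᴹ -B                ≈⟨ linearCombination-+ M b (-_ ∘ b) v ⟩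
        linearCombination (λ i → b i + - b i) v   ≈⟨ linearCombination-cong M v (λ i → -‿inverseʳ (b i)) ⟩
        linearCombination (λ _ → 0#) v             ≈⟨ linearCombination-0 M v ⟩
        0ᴹ                                         ∎) i)
      where -B = linearCombination (-_ ∘ b) v

    coefficients-injective : ∀ {k} {v : Vector Carrierᴹ k} {x y}
      (x∈ : x ∈ Span v) (y∈ : y ∈ Span v) →
      (∀ i → proj₁ x∈ i ≈ proj₁ y∈ i) → x ≈ᴹ y
    coefficients-injective {v = v} (a , x≈) (b , y≈) a≈b =
      ≈ᴹ-trans x≈ (≈ᴹ-trans (linearCombination-cong M v a≈b) (≈ᴹ-sym y≈))

    open CommutativeSemigroupProperties
      (CommutativeMonoid.commutativeSemigroup +ᴹ-commutativeMonoid)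
      using (interchange)

    -- `t < r +ℕ s` unfolds to `suc t ≤ r +ℕ s`, the form that counting yields. That `h` is nonzero
    -- enters as cancellation of scalars, since in an abstract module there is no entry to point at.
    independentSums⇒< : 1 < q → ∀ {t r s} {u v : Vector Carrierᴹ t}
      {b : Vector Carrierᴹ r} {b′ : Vector Carrierᴹ s} {h} →
      (∀ i → u i ∈ Span b) → (∀ i → v i ∈ Span b′) →
      LinearlyIndependent (λ i → u i +ᴹ v i) →
      h ∈ Span b → h ∈ Span b′ →
      (∀ {x y} → x *ₗ h ≈ᴹ y *ₗ h → x ≈ y) → t < r +ℕ s
    independentSums⇒< 1<q {t} {r} {s} {u} {v} {b} {b′} {h} u∈ v∈ ind h∈ h∈′ h-cancel =
      vectorInjection⇒≤ 1<q coefficients coefficients-inj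
      where
      -- The two components of a combination of the pairs: `tail a` weighs the `(u i , v i)` and
      -- `head a` weighs `(h , -h)`.
      left right : Vector Carrier (suc t) → Carrierᴹ
      left  a = linearCombination (tail a) u +ᴹ head a *ₗ h
      right a = linearCombination (tail a) v +ᴹ (- head a) *ₗ h

      left∈ : ∀ a → left a ∈ Span b
      left∈ a = Span-+ M (linearCombination∈Span (tail a) u∈) (Span-* M (head a) h∈)

      right∈ : ∀ a → right a ∈ Span b′
      right∈ a = Span-+ M (linearCombination∈Span (tail a) v∈) (Span-* M (- head a) h∈′)

      left+right : ∀ a → left a +ᴹ right a ≈ᴹ linearCombination (tail a) (λ i → u i +ᴹ v i)
      left+right a = begin
        (U +ᴹ x *ₗ h) +ᴹ (V +ᴹ (- x) *ₗ h)   ≈⟨ interchange U _ V _ ⟩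
        (U +ᴹ V) +ᴹ (x *ₗ h +ᴹ (- x) *ₗ h)   ≈⟨ +ᴹ-congˡ (*ₗ-distribʳ h x (- x)) ⟨
        (U +ᴹ V) +ᴹ (x + - x) *ₗ h           ≈⟨ +ᴹ-congˡ (*ₗ-congʳ (-‿inverseʳ x)) ⟩
        (U +ᴹ V) +ᴹ 0# *ₗ h                  ≈⟨ +ᴹ-congˡ (*ₗ-zeroˡ h) ⟩
        (U +ᴹ V) +ᴹ 0ᴹ                       ≈⟨ +ᴹ-identityʳ _ ⟩
        U +ᴹ V                               ≈⟨ linearCombination-+ᴹ (tail a) u v ⟨
        linearCombination (tail a) (λ i → u i +ᴹ v i) ∎
        where
        x = head a
        U = linearCombination (tail a) u
        V = linearCombination (tail a) v

      coefficients : Vector Carrier (suc t) → Vector Carrier (r +ℕ s)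
      coefficients a = proj₁ (left∈ a) ++ proj₁ (right∈ a)

      coefficients-inj : ∀ {a a′} → (∀ i → coefficients a i ≈ coefficients a′ i) →
                         ∀ i → a i ≈ a′ i
      coefficients-inj {a} {a′} eq = λ where
          -- Once the tails agree, the `u` parts cancel from `left≈`, leaving two multiples of `h`.
          zero    → h-cancel (∙-cancelˡ (linearCombination (tail a) u) _ _ (begin
            linearCombination (tail a) u +ᴹ head a *ₗ h    ≈⟨ left≈ ⟩
            linearCombination (tail a′) u +ᴹ head a′ *ₗ h
              ≈⟨ +ᴹ-congʳ (linearCombination-cong M u tail≈) ⟨
            linearCombination (tail a) u +ᴹ head a′ *ₗ h   ∎))
          (suc i) → tail≈ i
        where
        open AbelianGroupProperties +ᴹ-abelianGroup using (∙-cancelˡ)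

        left≈ : left a ≈ᴹ left a′
        left≈ = coefficients-injective (left∈ a) (left∈ a′) (λ i → ≡.subst₂ _≈_
          (lookup-++ˡ (proj₁ (left∈ a)) (proj₁ (right∈ a)) i)
          (lookup-++ˡ (proj₁ (left∈ a′)) (proj₁ (right∈ a′)) i)
          (eq (i ↑ˡ s)))

        right≈ : right a ≈ᴹ right a′
        right≈ = coefficients-injective (right∈ a) (right∈ a′) (λ i → ≡.subst₂ _≈_
          (lookup-++ʳ (proj₁ (left∈ a)) (proj₁ (right∈ a)) i)
          (lookup-++ʳ (proj₁ (left∈ a′)) (proj₁ (right∈ a′)) i)
          (eq (r ↑ʳ i)))

        tail≈ : ∀ i → tail a i ≈ tail a′ i
        -- In the sum of the two components the multiples of `h` cancel.
        tail≈ = independent⇒injective ind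
          (≈ᴹ-trans (≈ᴹ-sym (left+right a)) (≈ᴹ-trans (+ᴹ-cong left≈ right≈) (left+right a′)))

-- Supports and ranks under addition.

module RankMetricLemmas {c ℓ₁ ℓ₂ c′ ℓ₁′ ℓ₂′ q q′}
  {K : FiniteField c ℓ₁ ℓ₂ q} {L : FiniteField c′ ℓ₁′ ℓ₂′ q′}
  (E : Extension K L) {m : ℕ} (Γ : Extension.Basis E m) (n : ℕ) where

  open RankMetric E Γ n
  open Extension E using (L-over-K)
  open FiniteFieldProperties K using (_≈?_; linearCombination-+; Span-resp; Span-0)
  open FiniteFieldLemmas K
  private
    module K = FiniteField K
    module L = FiniteField L
    module KM = LeftModule Kⁿ
    module LM = LeftModule Lⁿ
  open Linear Kⁿ using (IsBasis; linearCombination)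

  -- `coordinates` is picked from a spanning proof; additivity comes from the independence of `Γ`.
  -- With `x` given only up to `L._≈_`, invariance under that equality is covered as well.
  coordinates-+ : ∀ {x y z} → x L.≈ y L.+ z → ∀ i →
    coordinates x i K.≈ coordinates y i K.+ coordinates z i
  coordinates-+ {x} {y} {z} x≈y+z = independent⇒injective L-over-K
    (Linear.IsBasis.independent (proj₂ Γ)) (begin
      reassemble (coordinates x)                           ≈⟨ expand x ⟨
      x                                                    ≈⟨ x≈y+z ⟩
      y L.+ z                                              ≈⟨ +ᴹ-cong (expand y) (expand z) ⟩
      reassemble (coordinates y) L.+ reassemble (coordinates z)
        ≈⟨ linearCombination-+ L-over-K (coordinates y) (coordinates z) (proj₁ Γ) ⟩
      reassemble (λ i → coordinates y i K.+ coordinates z i) ∎)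
    where
    open SetoidReasoning L.setoid
    open LeftModule L-over-K using (+ᴹ-cong)

    reassemble : Vector K.Carrier m → L.Carrier
    reassemble a = Linear.linearCombination L-over-K a (proj₁ Γ)

    expand : ∀ x → x L.≈ reassemble (coordinates x)
    expand x = proj₂ (Linear.IsBasis.spanning (proj₂ Γ) {x} tt)

  -- The same row coefficients `a` serve for all three matrices.
  σ-+ : ∀ {x y z} → x LM.≈ᴹ y LM.+ᴹ z → ∀ {u} → u ∈ σ x →
        ∃[ v ] ∃[ w ] v ∈ σ y × w ∈ σ z × u KM.≈ᴹ v KM.+ᴹ w
  σ-+ {x} {y} {z} x≈y+z (a , u≈) =
    linearCombination a (Mat y) , linearCombination a (Mat z) ,
    (a , KM.≈ᴹ-refl) , (a , KM.≈ᴹ-refl) ,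
    KM.≈ᴹ-trans u≈ (KM.≈ᴹ-trans
      (linearCombination-congʳ Kⁿ a (λ i j → coordinates-+ (x≈y+z j) i))
      (linearCombination-+ᴹ Kⁿ a (Mat y) (Mat z)))

  rk-+-< : 1 < q → ∀ {x y z} → x LM.≈ᴹ y LM.+ᴹ z →
           ∀ {h} → h ∈ σ y → h ∈ σ z → ∀ {j} → ¬ h j K.≈ K.0# → rk x < rk y +ℕ rk z
  rk-+-< 1<q {x} {y} {z} x≈y+z h∈σy h∈σz {j} hⱼ≉0 =
    independentSums⇒< Kⁿ 1<q
      (λ i → IsBasis.spanning basis-y (proj₁ (proj₂ (proj₂ (split i)))))
      (λ i → IsBasis.spanning basis-z (proj₁ (proj₂ (proj₂ (proj₂ (split i))))))
      (λ a a≈0 → IsBasis.independent basis-x a (KM.≈ᴹ-trans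
        (linearCombination-congʳ Kⁿ a (λ i → proj₂ (proj₂ (proj₂ (proj₂ (split i)))))) a≈0))
      (IsBasis.spanning basis-y h∈σy) (IsBasis.spanning basis-z h∈σz)
      -- The scalars are compared at entry `j`, where `h` is invertible.
      (λ {s} {t} sh≈th → *-cancelʳ s t hⱼ≉0 (sh≈th j))
    where
    basis-x = proj₂ (proj₂ (σ-dimension x))
    basis-y = proj₂ (proj₂ (σ-dimension y))
    basis-z = proj₂ (proj₂ (σ-dimension z))
    split = λ i → σ-+ x≈y+z (IsBasis.member basis-x i)

  -- From intersecting to separating codes.

  module _ {p} {C : Pred LM.Carrierᴹ p} (isSubspace : Linear.IsSubspace Lⁿ C) where
    open Linear.IsSubspace isSubspace

    private
      infixl 6 _⊖_
      _⊖_ : LM.Carrierᴹ → LM.Carrierᴹ → LM.Carrierᴹ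
      x ⊖ y = x LM.+ᴹ LM.-ᴹ y

    -∈ : ∀ {x y} → x ∈ C → y ∈ C → x ⊖ y ∈ C
    -∈ {x} {y} x∈ y∈ = resp
      (λ j → CommutativeRing.+-congˡ L.commutativeRing (RingProperties.-1*x≈-x L.ring (y j)))
      -- `IsSubspace` has no closure under negation, so `y` is scaled by minus one.
      (+∈ x∈ (*∈ (L.- L.1#) y∈))

    -- `Intersecting` is a negation and supplies no common vector, so the argument is by
    -- contradiction, which decidability of `<` permits: if the strict inequality fails, the two
    -- supports meet only in zero.
    intersecting⇒separating₂₁ : 1 < q → Intersecting C → Separating₂₁ C
    intersecting⇒separating₂₁ 1<q intersecting {x} {y} {z} x∈ y∈ z∈ x≉y y≉z _ =
      decidable-stable (_ ℕ.<? _) λ rk≮ →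
        intersecting (-∈ x∈ y∈) (-∈ y∈ z∈)
          (x≉y ∘ λ e j → L-x∙y⁻¹≈ε⇒x≈y (x j) (y j) (e j))
          (y≉z ∘ λ e j → L-x∙y⁻¹≈ε⇒x≈y (y j) (z j) (e j))
          -- A nonzero entry of a common vector `h` would give the strict inequality, so each entry
          -- vanishes by decidability of equality in `K`.
          ( (λ { {h} (h∈ , h∈′) j → decidable-stable (h j ≈? K.0#)
                 (λ hⱼ≉0 → rk≮ (rk-+-< 1<q telescope h∈ h∈′ hⱼ≉0)) })
          , λ h≈0 → zero∈ (x ⊖ y) h≈0 , zero∈ (y ⊖ z) h≈0 )
      where
      open RingProperties L.ring using () renaming (x∙y⁻¹≈ε⇒x≈y to L-x∙y⁻¹≈ε⇒x≈y)

      zero∈ : ∀ w {h} → h KM.≈ᴹ KM.0ᴹ → h ∈ σ w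
      zero∈ w h≈0 = Span-resp Kⁿ {v = Mat w} (KM.≈ᴹ-sym h≈0) (Span-0 Kⁿ {v = Mat w})

      telescope : x ⊖ z LM.≈ᴹ (x ⊖ y) LM.+ᴹ (y ⊖ z)
      telescope j = begin
        x j + - z j                     ≈⟨ +-congʳ (//-rightDividesˡ (y j) (x j)) ⟨
        ((x j + - y j) + y j) + - z j   ≈⟨ +-assoc (x j + - y j) (y j) (- z j) ⟩
        (x j + - y j) + (y j + - z j)   ∎
        where
        open CommutativeRing L.commutativeRing using (_+_; -_; +-congʳ; +-assoc)
        open RingProperties L.ring using (//-rightDividesˡ)
        open SetoidReasoning L.setoid

theorem5p3 : ∀ {c ℓ₁ ℓ₂ c′ ℓ₁′ ℓ₂′ p : Level} {q m n k d : ℕ} →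
    IsPrimePower q → 1 ≤ m → 1 ≤ n →
    (K : FiniteField c ℓ₁ ℓ₂ q) (L : FiniteField c′ ℓ₁′ ℓ₂′ (q ^ m)) →
    (E : Extension K L) (Γ : Extension.Basis E m) →
    let open RankMetric E Γ n in
    (C : Pred (LeftModule.Carrierᴹ Lⁿ) p) →
    IsCode C k d → Intersecting C → Separating₂₁ C
theorem5p3 {n = n} primePower _ _ K L E Γ C isCode =
  RankMetricLemmas.intersecting⇒separating₂₁ E Γ n
    (RankMetric.IsCode.isSubspace isCode) (primePower⇒1< primePower)
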